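{- Let $n$ be a positive integer and let $A=[a_{i,j}]_{1\le i,j\le n}$ be a matrix over a commutative ring. Suppose that $a_{i,j}=0$ whenever $i+j$ is an even number greater than two. (i) If $n=2m$ for some positive integer $m$, then $$\mathrm{per}(A)=\mathrm{per}[a_{2i,2j-1}]_{1\le i,j\le m}\cdot\mathrm{per}[a_{2i-1,2j}]_{1\le i,j\le m}$$ and $$\det(A)=(-1)^m\det[a_{2i,2j-1}]_{1\le i,j\le m}\cdot\det[a_{2i-1,2j}]_{1\le i,j\le m}.$$ (ii) If $n=2m+1$ for some positive integer $m$, then $$\mathrm{per}(A)=a_{1,1}\cdot\mathrm{per}[a_{2i,2j+1}]_{1\le i,j\le m}\cdot\mathrm{per}[a_{2i+1,2j}]_{1\le i,j\le m}$$ and $$\det(A)=(-1)^m a_{1,1}\det[a_{2i,2j+1}]_{1\le i,j\le m}\cdot\det[a_{2i+1,2j}]_{1\le i,j\le m}.$$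
   Context: For an $n\times n$ matrix $A=[a_{i,j}]_{1\le i,j\le n}$ over a commutative ring, $\det(A)=\sum_{\sigma\in S_n}\mathrm{sign}(\sigma)\prod_{i=1}^n a_{i,\sigma(i)}$ is the determinant and $\mathrm{per}(A)=\sum_{\sigma\in S_n}\prod_{i=1}^n a_{i,\sigma(i)}$ is the permanent, where $S_n$ is the symmetric group on $\{1,\ldots,n\}$. -}

module Defs where

open import Algebra.Bundles using (CommutativeRing)
open import Data.Fin.Base using (Fin; zero; suc; toℕ; fromℕ<; punchIn)
import Data.Fin.Properties as Fin
open import Data.Fin.Permutation as Perm using (Permutation′; _⟨$⟩ʳ_; insert; remove)
open import Data.List.Base using (List; []; _∷_; map; concatMap; foldr; filter; length; allFin; cartesianProduct)
open import Data.List.Relation.Unary.All as All using ()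
open import Data.List.Relation.Unary.Any as Any using (Any; here)
open import Data.List.Relation.Unary.AllPairs as AllPairs using (AllPairs; []; _∷_)
import Data.List.Relation.Unary.All.Properties as All
import Data.List.Relation.Unary.Any.Properties as Any
import Data.List.Relation.Unary.AllPairs.Properties as AllPairs
open import Data.List.Membership.Propositional.Properties using (∈-allFin)
open import Data.Nat.Base as ℕ using (ℕ; zero; suc; NonZero; z≤n; s≤s; _≤_)
import Data.Nat.Properties as ℕ
open import Data.Product.Base using (_,_)
open import Relation.Binary.PropositionalEquality using (_≡_; refl; sym; trans; cong)
open import Relation.Nullary.Negation using (¬_)
open import Relation.Nullary.Decidable using (_×-dec_)

-- The library's indices start at 0; pos is the index counted from 1.
pos : ∀ {n} → Fin n → ℕ
pos i = suc (toℕ i)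

at : ∀ {n} (k : ℕ) → .(1 ≤ k) → .(k ≤ n) → Fin n
at zero    ()
at (suc k) _ k<n = fromℕ< k<n

pos-at : ∀ {n} k .(1≤k : 1 ≤ k) .(k≤n : k ≤ n) → pos (at k 1≤k k≤n) ≡ k
pos-at zero    ()
pos-at (suc k) _ k<n = cong suc (Fin.toℕ-fromℕ< k<n)

first : ∀ {n} → .{{NonZero n}} → Fin n
first {n} = at 1 (s≤s z≤n) (ℕ.>-nonZero⁻¹ n)

at2i : ∀ {n m} → .(2 ℕ.* m ≤ n) → Fin m → Fin n
at2i 2m≤n i = at (2 ℕ.* pos i) (s≤s z≤n)
  (ℕ.≤-trans (ℕ.*-monoʳ-≤ 2 (Fin.toℕ<n i)) 2m≤n)

at2i-1 : ∀ {n m} → .(2 ℕ.* m ≤ n) → Fin m → Fin n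
at2i-1 2m≤n i = at (2 ℕ.* pos i ℕ.∸ 1)
  (ℕ.∸-monoˡ-≤ 1 (ℕ.*-monoʳ-≤ 2 (s≤s (z≤n {toℕ i}))))
  (ℕ.≤-trans (ℕ.m∸n≤m (2 ℕ.* pos i) 1) (ℕ.≤-trans (ℕ.*-monoʳ-≤ 2 (Fin.toℕ<n i)) 2m≤n))

at2i+1 : ∀ {n m} → .(2 ℕ.* m ℕ.+ 1 ≤ n) → Fin m → Fin n
at2i+1 2m+1≤n i = at (2 ℕ.* pos i ℕ.+ 1) (s≤s z≤n)
  (ℕ.≤-trans (ℕ.+-monoˡ-≤ 1 (ℕ.*-monoʳ-≤ 2 (Fin.toℕ<n i))) 2m+1≤n)

-- A permutation of n + 1 points is fixed by the image j of the first point
-- together with a permutation of the remaining n points.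
perms : ∀ n → List (Permutation′ n)
perms zero    = Perm.id ∷ []
perms (suc n) = concatMap (λ j → map (insert zero j) (perms n)) (allFin (suc n))

-- perms n runs through the symmetric group exactly once: every permutation
-- occurs, and no two entries agree as functions.
perms-complete : ∀ n (π : Permutation′ n) → Any (π Perm.≈_) (perms n)
perms-complete zero    π = here λ ()
perms-complete (suc n) π =
  Any.concat⁺ (Any.map⁺ (Any.map (λ { refl → inBlock }) (∈-allFin (π ⟨$⟩ʳ zero))))
  where
  inBlock : Any (π Perm.≈_) (map (insert zero (π ⟨$⟩ʳ zero)) (perms n))
  inBlock = Any.map⁺ (Any.map
    (λ {ρ} eq → λ
      { zero    → refl
      ; (suc k) → trans (Perm.punchIn-permute π zero k)
                 (trans (cong (punchIn (π ⟨$⟩ʳ zero)) (eq k))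
                        (sym (Perm.insert-punchIn zero (π ⟨$⟩ʳ zero) ρ k))) })
    (perms-complete n (remove zero π)))

perms-distinct : ∀ n → AllPairs (λ π ρ → ¬ π Perm.≈ ρ) (perms n)
perms-distinct zero    = All.[] ∷ []
perms-distinct (suc n) = AllPairs.concat⁺
  (All.map⁺ (All.tabulate λ {j} _ → AllPairs.map⁺ (AllPairs.map (sameImage j) (perms-distinct n))))
  (AllPairs.map⁺ (AllPairs.tabulate⁺ λ i≢j →
    All.map⁺ (All.tabulate λ _ → All.map⁺ (All.tabulate λ _ eq → i≢j (eq zero)))))
  where
  sameImage : ∀ j {π ρ : Permutation′ n} → ¬ π Perm.≈ ρ → ¬ insert zero j π Perm.≈ insert zero j ρ
  sameImage j {π} {ρ} π≉ρ eq = π≉ρ λ k → Fin.punchIn-injective j _ _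
    (trans (sym (Perm.insert-punchIn zero j π k))
    (trans (eq (suc k)) (Perm.insert-punchIn zero j ρ k)))

inversions : ∀ {n} → Permutation′ n → ℕ
inversions {n} σ = length (filter
  (λ (i , j) → (i Fin.<? j) ×-dec ((σ ⟨$⟩ʳ j) Fin.<? (σ ⟨$⟩ʳ i)))
  (cartesianProduct (allFin n) (allFin n)))

module Matrices {c ℓ} (R : CommutativeRing c ℓ) where
  open CommutativeRing R using (Carrier; _+_; _*_; -_; 0#; 1#; semiring; *-commutativeMonoid)
  open import Algebra.Properties.Semiring.Exp semiring public using (_^_)
  open import Algebra.Properties.CommutativeMonoid.Sum *-commutativeMonoid
    using () renaming (sum to ∏)

  Matrix : ℕ → Set c
  Matrix n = Fin n → Fin n → Carrier

  ∑ₛ : ∀ n → (Permutation′ n → Carrier) → Carrier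
  ∑ₛ n f = foldr _+_ 0# (map f (perms n))

  sign : ∀ {n} → Permutation′ n → Carrier
  sign σ = (- 1#) ^ inversions σ

  per : ∀ {n} → Matrix n → Carrier
  per {n} A = ∑ₛ n λ σ → ∏ λ i → A i (σ ⟨$⟩ʳ i)

  det : ∀ {n} → Matrix n → Carrier
  det {n} A = ∑ₛ n λ σ → sign σ * ∏ λ i → A i (σ ⟨$⟩ʳ i)

{-# OPTIONS --safe #-}

-- The permanent and the determinant are the cases x = 1 and x = -1 of
-- wper A = Σ_σ x^inv(σ) Π_i a_{i,σ(i)} with x² = 1.  Split the rows and the
-- columns of A into a left and a right class such that every entry of mixed
-- class is 0.  Expansion along the first row shows by induction that wper A
-- is, up to a power of x counting inversions of the two splittings, the product
-- for the two diagonal blocks, and 0 if these blocks are not square.  Here rows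
-- and columns are split by parity, in opposite ways.  The exceptional entry
-- a_{1,1} has a minor with nonsquare blocks if n is even; if n is odd, it
-- carries the only term of the expansion that survives.
module Submission where

open import Defs
open import Algebra.Bundles using (CommutativeRing)
import Algebra.Properties.CommutativeMonoid.Sum as CommutativeMonoidSum
import Algebra.Properties.Ring as RingProperties
import Algebra.Properties.Semiring.Exp as SemiringExp
import Algebra.Properties.Semiring.Sum as SemiringSum
import Algebra.Solver.CommutativeMonoid as CommutativeMonoidSolver
open import Data.Bool.Base using (Bool; true; false; _∧_; if_then_else_)
open import Data.Empty using (⊥-elim)
open import Data.Fin.Base using (Fin; zero; suc; toℕ; punchIn)
open import Data.Fin.Permutation using (Permutation′; _⟨$⟩ʳ_; insert; insert-punchIn)
import Data.Fin.Properties as Fin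
open import Data.List.Base using (List; []; _∷_; _++_; map; concatMap; foldr; filter; length; tabulate; cartesianProduct)
open import Data.List.Properties using (map-tabulate; filter-++; length-++; map-∘)
open import Data.Nat.Base as ℕ using (ℕ; zero; suc; NonZero; _≤_; _<_; _<ᵇ_; z≤n; s≤s)
open import Data.Nat.Divisibility using (_∣_; divides)
open import Data.Nat.Properties as ℕ using (≤-reflexive; m+n≤o⇒m≤o)
open import Data.Nat.Solver using (module +-*-Solver)
open import Data.Product.Base using (_×_; _,_; proj₁; proj₂; ∃)
open import Function.Base using (_∘_; id)
open import Relation.Binary.PropositionalEquality as ≡ using (_≡_; _≢_; refl; cong; cong₂)
import Relation.Binary.Reasoning.Setoid as SetoidReasoning
open import Relation.Nullary.Decidable using (does; _×-dec_)
open import Relation.Unary using (Pred; Decidable)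

private
  module Σℕ = CommutativeMonoidSum ℕ.+-0-commutativeMonoid

-- Inversions

𝟙 : Bool → ℕ
𝟙 b = if b then 1 else 0

length-filter-tabulate : ∀ {a p} {A : Set a} {P : Pred A p} (P? : Decidable P) {n} (f : Fin n → A) →
  length (filter P? (tabulate f)) ≡ Σℕ.sum (λ i → 𝟙 (does (P? (f i))))
length-filter-tabulate P? {zero}  f = refl
length-filter-tabulate P? {suc n} f with does (P? (f zero))
... | true  = cong suc (length-filter-tabulate P? (f ∘ suc))
... | false = length-filter-tabulate P? (f ∘ suc)

length-filter-cartesianProduct : ∀ {a b p} {A : Set a} {B : Set b} {P : Pred (A × B) p} (P? : Decidable P)
  {m n} (f : Fin m → A) (g : Fin n → B) →
  length (filter P? (cartesianProduct (tabulate f) (tabulate g))) ≡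
  Σℕ.sum (λ i → Σℕ.sum (λ j → 𝟙 (does (P? (f i , g j)))))
length-filter-cartesianProduct P? {zero}  f g = refl
length-filter-cartesianProduct P? {suc m} f g = begin
  length (filter P? (map (f zero ,_) (tabulate g) ++ rest))
    ≡⟨ cong length (filter-++ P? (map (f zero ,_) (tabulate g)) rest) ⟩
  length (filter P? (map (f zero ,_) (tabulate g)) ++ filter P? rest)
    ≡⟨ length-++ (filter P? (map (f zero ,_) (tabulate g))) ⟩
  length (filter P? (map (f zero ,_) (tabulate g))) ℕ.+ length (filter P? rest)
    ≡⟨ cong₂ ℕ._+_
         (≡.trans (cong (length ∘ filter P?) (map-tabulate g (f zero ,_)))
                  (length-filter-tabulate P? ((f zero ,_) ∘ g)))
         (length-filter-cartesianProduct P? (f ∘ suc) g) ⟩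
  Σℕ.sum (λ i → Σℕ.sum (λ j → 𝟙 (does (P? (f i , g j))))) ∎
  where
  open ≡.≡-Reasoning
  rest = cartesianProduct (tabulate (f ∘ suc)) (tabulate g)

-- The form to which `does` of the decision inside `inversions` reduces, so `inversions-sum` is an
-- instance of the general count.
inverted : ∀ {n} → Permutation′ n → Fin n → Fin n → Bool
inverted σ i j = (toℕ i <ᵇ toℕ j) ∧ (toℕ (σ ⟨$⟩ʳ j) <ᵇ toℕ (σ ⟨$⟩ʳ i))

-- As a double sum, the count separates the first row by computation, and sums can be reindexed
-- along a permutation.
inversions-sum : ∀ {n} (σ : Permutation′ n) →
  inversions σ ≡ Σℕ.sum (λ i → Σℕ.sum (λ j → 𝟙 (inverted σ i j)))
inversions-sum σ = length-filter-cartesianProduct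
  (λ (i , j) → (i Fin.<? j) ×-dec ((σ ⟨$⟩ʳ j) Fin.<? (σ ⟨$⟩ʳ i))) id id

punchIn-<ᵇ : ∀ {n} (i : Fin (suc n)) j k → (toℕ (punchIn i j) <ᵇ toℕ (punchIn i k)) ≡ (toℕ j <ᵇ toℕ k)
punchIn-<ᵇ zero    j       k       = refl
punchIn-<ᵇ (suc i) zero    zero    = refl
punchIn-<ᵇ (suc i) zero    (suc k) = refl
punchIn-<ᵇ (suc i) (suc j) zero    = refl
punchIn-<ᵇ (suc i) (suc j) (suc k) = punchIn-<ᵇ i j k

-- Numbers below the hole stay where they are; all others are pushed past it.
punchIn-<ᵇ-hole : ∀ {n} (i : Fin (suc n)) j → (toℕ (punchIn i j) <ᵇ toℕ i) ≡ (toℕ j <ᵇ toℕ i)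
punchIn-<ᵇ-hole zero    j       = refl
punchIn-<ᵇ-hole (suc i) zero    = refl
punchIn-<ᵇ-hole (suc i) (suc j) = punchIn-<ᵇ-hole i j

sum-<ᵇ : ∀ {n} (i : Fin (suc n)) → Σℕ.sum (λ (k : Fin n) → 𝟙 (toℕ k <ᵇ toℕ i)) ≡ toℕ i
sum-<ᵇ {n}     zero    = Σℕ.sum-replicate-zero n
sum-<ᵇ {suc n} (suc i) = cong suc (sum-<ᵇ i)

-- The first point is inverted with exactly those points whose image lies below `j`, and there are
-- `toℕ j` of them. Pairs of later points keep their order because `punchIn j` is monotone.
inversions-insert : ∀ {n} (j : Fin (suc n)) (π : Permutation′ n) →
  inversions (insert zero j π) ≡ toℕ j ℕ.+ inversions π
inversions-insert {n} j π = begin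
  inversions σ
    -- Pairs whose second member is the first point contribute 0 by computation, which leaves the
    -- first row and the pairs of later points.
    ≡⟨ inversions-sum σ ⟩
  Σℕ.sum (λ k → 𝟙 (toℕ (σ ⟨$⟩ʳ suc k) <ᵇ toℕ j)) ℕ.+ Σℕ.sum (λ i → Σℕ.sum (λ k → 𝟙 (inverted σ (suc i) (suc k))))
    ≡⟨ cong₂ ℕ._+_ (Σℕ.sum-cong-≗ (λ k → cong 𝟙 (firstRow k)))
         (Σℕ.sum-cong-≗ (λ i → Σℕ.sum-cong-≗ (λ k → cong 𝟙 (laterRow i k)))) ⟩
  Σℕ.sum (λ k → 𝟙 (toℕ (π ⟨$⟩ʳ k) <ᵇ toℕ j)) ℕ.+ Σℕ.sum (λ i → Σℕ.sum (λ k → 𝟙 (inverted π i k)))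
    -- The images `π k` run through `Fin n` once, so `π` disappears from the first count.
    ≡⟨ cong₂ ℕ._+_ (Σℕ.sum-permute (λ k → 𝟙 (toℕ k <ᵇ toℕ j)) π) (inversions-sum π) ⟨
  Σℕ.sum (λ (k : Fin n) → 𝟙 (toℕ k <ᵇ toℕ j)) ℕ.+ inversions π
    ≡⟨ cong (ℕ._+ inversions π) (sum-<ᵇ j) ⟩
  toℕ j ℕ.+ inversions π ∎
  where
  open ≡.≡-Reasoning
  σ = insert zero j π
  firstRow : ∀ k → (toℕ (σ ⟨$⟩ʳ suc k) <ᵇ toℕ j) ≡ (toℕ (π ⟨$⟩ʳ k) <ᵇ toℕ j)
  firstRow k = ≡.trans (cong (λ l → toℕ l <ᵇ toℕ j) (insert-punchIn zero j π k))
                       (punchIn-<ᵇ-hole j (π ⟨$⟩ʳ k))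
  laterRow : ∀ i k → inverted σ (suc i) (suc k) ≡ inverted π i k
  laterRow i k = cong ((toℕ i <ᵇ toℕ k) ∧_)
    (≡.trans (cong₂ (λ l l′ → toℕ l <ᵇ toℕ l′) (insert-punchIn zero j π k) (insert-punchIn zero j π i))
             (punchIn-<ᵇ j (π ⟨$⟩ʳ k) (π ⟨$⟩ʳ i)))

-- Shuffles

-- A word of length n in p letters ˡ and q letters ʳ, that is, a splitting of
-- Fin n into two blocks of sizes p and q, enumerated in order by injˡ and injʳ.
data Shuffle : ℕ → ℕ → ℕ → Set where
  []  : Shuffle 0 0 0
  ˡ∷_ : ∀ {p q n} → Shuffle p q n → Shuffle (suc p) q (suc n)
  ʳ∷_ : ∀ {p q n} → Shuffle p q n → Shuffle p (suc q) (suc n)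

infixr 5 ˡ∷_ ʳ∷_

injˡ : ∀ {p q n} → Shuffle p q n → Fin p → Fin n
injˡ (ˡ∷ s) zero    = zero
injˡ (ˡ∷ s) (suc i) = suc (injˡ s i)
injˡ (ʳ∷ s) i       = suc (injˡ s i)

injʳ : ∀ {p q n} → Shuffle p q n → Fin q → Fin n
injʳ (ˡ∷ s) i       = suc (injʳ s i)
injʳ (ʳ∷ s) zero    = zero
injʳ (ʳ∷ s) (suc i) = suc (injʳ s i)

-- Counts the pairs of a letter ʳ and a later letter ˡ, that is, the inversions of the permutation
-- that moves the left class to the front.
shuffleInversions : ∀ {p q n} → Shuffle p q n → ℕ
shuffleInversions []             = 0
shuffleInversions (ˡ∷ s)         = shuffleInversions s
shuffleInversions (ʳ∷_ {p = p} s) = p ℕ.+ shuffleInversions s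

-- The recursion needs a tail of successor length, hence the case split on `n`; a tail of length 0
-- cannot contain the letter ˡ to be removed.
removeˡ : ∀ {p q n} → Shuffle (suc p) q (suc n) → Fin (suc p) → Shuffle p q n
removeˡ                       (ˡ∷ s) zero    = s
removeˡ {suc p} {n = suc n}   (ˡ∷ s) (suc k) = ˡ∷ removeˡ s k
removeˡ {n = zero}            (ʳ∷ ()) k
removeˡ {n = suc n}           (ʳ∷ s) k       = ʳ∷ removeˡ s k

removeʳ : ∀ {p q n} → Shuffle p (suc q) (suc n) → Fin (suc q) → Shuffle p q n
removeʳ                         (ʳ∷ s) zero    = s
removeʳ {q = suc q} {n = suc n} (ʳ∷ s) (suc k) = ʳ∷ removeʳ s k
removeʳ {n = zero}              (ˡ∷ ()) k
removeʳ {n = suc n}             (ˡ∷ s) k       = ˡ∷ removeʳ s k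

-- Together with the next lemma: deleting a left column turns the left block into one of its own
-- minors and leaves the right block whole. The versions for `removeʳ` exchange the roles.
punchIn-injˡ-removeˡ : ∀ {p q n} (s : Shuffle (suc p) q (suc n)) k i →
  punchIn (injˡ s k) (injˡ (removeˡ s k) i) ≡ injˡ s (punchIn k i)
punchIn-injˡ-removeˡ                     (ˡ∷ s)  zero    i       = refl
punchIn-injˡ-removeˡ {suc p} {n = suc n} (ˡ∷ s)  (suc k) zero    = refl
punchIn-injˡ-removeˡ {suc p} {n = suc n} (ˡ∷ s)  (suc k) (suc i) = cong suc (punchIn-injˡ-removeˡ s k i)
punchIn-injˡ-removeˡ {n = zero}          (ʳ∷ ()) k       i
punchIn-injˡ-removeˡ {n = suc n}         (ʳ∷ s)  k       i       = cong suc (punchIn-injˡ-removeˡ s k i)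

punchIn-injʳ-removeˡ : ∀ {p q n} (s : Shuffle (suc p) q (suc n)) k i →
  punchIn (injˡ s k) (injʳ (removeˡ s k) i) ≡ injʳ s i
punchIn-injʳ-removeˡ                     (ˡ∷ s)  zero    i       = refl
punchIn-injʳ-removeˡ {suc p} {n = suc n} (ˡ∷ s)  (suc k) i       = cong suc (punchIn-injʳ-removeˡ s k i)
punchIn-injʳ-removeˡ {n = zero}          (ʳ∷ ()) k       i
punchIn-injʳ-removeˡ {n = suc n}         (ʳ∷ s)  k       zero    = refl
punchIn-injʳ-removeˡ {n = suc n}         (ʳ∷ s)  k       (suc i) = cong suc (punchIn-injʳ-removeˡ s k i)

punchIn-injʳ-removeʳ : ∀ {p q n} (s : Shuffle p (suc q) (suc n)) k i →
  punchIn (injʳ s k) (injʳ (removeʳ s k) i) ≡ injʳ s (punchIn k i)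
punchIn-injʳ-removeʳ                         (ʳ∷ s)  zero    i       = refl
punchIn-injʳ-removeʳ {q = suc q} {n = suc n} (ʳ∷ s)  (suc k) zero    = refl
punchIn-injʳ-removeʳ {q = suc q} {n = suc n} (ʳ∷ s)  (suc k) (suc i) = cong suc (punchIn-injʳ-removeʳ s k i)
punchIn-injʳ-removeʳ {n = zero}              (ˡ∷ ()) k       i
punchIn-injʳ-removeʳ {n = suc n}             (ˡ∷ s)  k       i       = cong suc (punchIn-injʳ-removeʳ s k i)

punchIn-injˡ-removeʳ : ∀ {p q n} (s : Shuffle p (suc q) (suc n)) k i →
  punchIn (injʳ s k) (injˡ (removeʳ s k) i) ≡ injˡ s i
punchIn-injˡ-removeʳ                         (ʳ∷ s)  zero    i       = refl
punchIn-injˡ-removeʳ {q = suc q} {n = suc n} (ʳ∷ s)  (suc k) i       = cong suc (punchIn-injˡ-removeʳ s k i)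
punchIn-injˡ-removeʳ {n = zero}              (ˡ∷ ()) k       i
punchIn-injˡ-removeʳ {n = suc n}             (ˡ∷ s)  k       zero    = refl
punchIn-injˡ-removeʳ {n = suc n}             (ˡ∷ s)  k       (suc i) = cong suc (punchIn-injˡ-removeʳ s k i)

-- Let e letters ʳ precede the k-th letter ˡ. Its position is k + e, and its removal destroys e
-- inversions.
shuffleInversions-removeˡ : ∀ {p q n} (s : Shuffle (suc p) q (suc n)) k →
  toℕ (injˡ s k) ℕ.+ shuffleInversions (removeˡ s k) ≡ toℕ k ℕ.+ shuffleInversions s
shuffleInversions-removeˡ                     (ˡ∷ s)  zero    = refl
shuffleInversions-removeˡ {suc p} {n = suc n} (ˡ∷ s)  (suc k) = cong suc (shuffleInversions-removeˡ s k)
shuffleInversions-removeˡ {n = zero}          (ʳ∷ ()) k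
shuffleInversions-removeˡ {p} {n = suc n}     (ʳ∷ s)  k       = begin
  suc (j ℕ.+ (p ℕ.+ w′)) ≡⟨ solve 3 (λ j p w → con 1 :+ (j :+ (p :+ w)) := con 1 :+ (p :+ (j :+ w))) refl j p w′ ⟩
  suc (p ℕ.+ (j ℕ.+ w′)) ≡⟨ cong (λ t → suc (p ℕ.+ t)) (shuffleInversions-removeˡ s k) ⟩
  suc (p ℕ.+ (toℕ k ℕ.+ w)) ≡⟨ solve 3 (λ p k w → con 1 :+ (p :+ (k :+ w)) := k :+ (con 1 :+ (p :+ w))) refl p (toℕ k) w ⟩
  toℕ k ℕ.+ (suc p ℕ.+ w) ∎
  where
  open ≡.≡-Reasoning
  open +-*-Solver
  j  = toℕ (injˡ s k)
  w  = shuffleInversions s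
  w′ = shuffleInversions (removeˡ s k)

-- The witness d is the number of letters ˡ to the right of the removed letter.
shuffleInversions-removeʳ : ∀ {p q n} (s : Shuffle p (suc q) (suc n)) k → ∃ λ d →
  toℕ (injʳ s k) ℕ.+ (shuffleInversions (removeʳ s k) ℕ.+ (d ℕ.+ d)) ≡ toℕ k ℕ.+ (p ℕ.+ shuffleInversions s)
shuffleInversions-removeʳ {p} (ʳ∷ s) zero = p ,
  solve 2 (λ w p → w :+ (p :+ p) := p :+ (p :+ w)) refl (shuffleInversions s) p
  where open +-*-Solver
shuffleInversions-removeʳ {p} {suc q} {suc n} (ʳ∷ s) (suc k) with shuffleInversions-removeʳ s k
... | d , eq = d , (begin
  suc (j ℕ.+ (p ℕ.+ w′ ℕ.+ (d ℕ.+ d)))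
    ≡⟨ solve 4 (λ j p w d → con 1 :+ (j :+ (p :+ w :+ (d :+ d))) := con 1 :+ (p :+ (j :+ (w :+ (d :+ d))))) refl j p w′ d ⟩
  suc (p ℕ.+ (j ℕ.+ (w′ ℕ.+ (d ℕ.+ d))))
    ≡⟨ cong (λ t → suc (p ℕ.+ t)) eq ⟩
  suc (p ℕ.+ (toℕ k ℕ.+ (p ℕ.+ w)))
    ≡⟨ solve 3 (λ p k w → con 1 :+ (p :+ (k :+ (p :+ w))) := con 1 :+ k :+ (p :+ (p :+ w))) refl p (toℕ k) w ⟩
  suc (toℕ k) ℕ.+ (p ℕ.+ (p ℕ.+ w)) ∎)
  where
  open ≡.≡-Reasoning
  open +-*-Solver
  j  = toℕ (injʳ s k)
  w  = shuffleInversions s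
  w′ = shuffleInversions (removeʳ s k)
shuffleInversions-removeʳ {n = zero} (ˡ∷ ()) k
shuffleInversions-removeʳ {suc p} {n = suc n} (ˡ∷ s) k with shuffleInversions-removeʳ s k
... | d , eq = d , ≡.trans (cong suc eq) (≡.sym (ℕ.+-suc (toℕ k) (p ℕ.+ shuffleInversions s)))


-- Alternating shuffles and indices counted from 1

alternatingˡ : ∀ m → Shuffle m m (m ℕ.* 2)
alternatingˡ zero    = []
alternatingˡ (suc m) = ˡ∷ ʳ∷ alternatingˡ m

-- Rows are split by `alternatingˡ` and columns by `alternatingʳ`, so the parities are opposite. The
-- length is `m * 2` because `suc m * 2` reduces to two successors, one per letter.
alternatingʳ : ∀ m → Shuffle m m (m ℕ.* 2)
alternatingʳ zero    = []
alternatingʳ (suc m) = ʳ∷ ˡ∷ alternatingʳ m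

toℕ-injˡ-alternatingˡ : ∀ m i → toℕ (injˡ (alternatingˡ m) i) ≡ toℕ i ℕ.* 2
toℕ-injˡ-alternatingˡ (suc m) zero    = refl
toℕ-injˡ-alternatingˡ (suc m) (suc i) = cong (2 ℕ.+_) (toℕ-injˡ-alternatingˡ m i)

toℕ-injʳ-alternatingˡ : ∀ m i → toℕ (injʳ (alternatingˡ m) i) ≡ suc (toℕ i ℕ.* 2)
toℕ-injʳ-alternatingˡ (suc m) zero    = refl
toℕ-injʳ-alternatingˡ (suc m) (suc i) = cong (2 ℕ.+_) (toℕ-injʳ-alternatingˡ m i)

toℕ-injˡ-alternatingʳ : ∀ m i → toℕ (injˡ (alternatingʳ m) i) ≡ suc (toℕ i ℕ.* 2)
toℕ-injˡ-alternatingʳ (suc m) zero    = refl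
toℕ-injˡ-alternatingʳ (suc m) (suc i) = cong (2 ℕ.+_) (toℕ-injˡ-alternatingʳ m i)

toℕ-injʳ-alternatingʳ : ∀ m i → toℕ (injʳ (alternatingʳ m) i) ≡ toℕ i ℕ.* 2
toℕ-injʳ-alternatingʳ (suc m) zero    = refl
toℕ-injʳ-alternatingʳ (suc m) (suc i) = cong (2 ℕ.+_) (toℕ-injʳ-alternatingʳ m i)

at-pos : ∀ {n} k .(1≤k : 1 ≤ k) .(k≤n : k ≤ n) (i : Fin n) → pos i ≡ k → at k 1≤k k≤n ≡ i
at-pos k 1≤k k≤n i pos≡k = Fin.toℕ-injective (ℕ.suc-injective (≡.trans (pos-at k 1≤k k≤n) (≡.sym pos≡k)))

2*suc : ∀ k → suc (suc (k ℕ.* 2)) ≡ 2 ℕ.* suc k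
2*suc k = ℕ.*-comm (suc k) 2

at2i-≡ : ∀ {n m} .(2m≤n : 2 ℕ.* m ≤ n) (i : Fin m) (k : Fin n) → toℕ k ≡ suc (toℕ i ℕ.* 2) → at2i 2m≤n i ≡ k
at2i-≡ 2m≤n i k eq = at-pos (2 ℕ.* pos i) (s≤s z≤n) _ k (≡.trans (cong suc eq) (2*suc (toℕ i)))

at2i-1-≡ : ∀ {n m} .(2m≤n : 2 ℕ.* m ≤ n) (i : Fin m) (k : Fin n) → toℕ k ≡ toℕ i ℕ.* 2 → at2i-1 2m≤n i ≡ k
at2i-1-≡ 2m≤n i k eq = at-pos (2 ℕ.* pos i ℕ.∸ 1) _ _ k
  (≡.trans (cong suc eq) (cong ℕ.pred (2*suc (toℕ i))))

at2i+1-≡ : ∀ {n m} .(2m+1≤n : 2 ℕ.* m ℕ.+ 1 ≤ n) (i : Fin m) (k : Fin n) →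
  toℕ k ≡ suc (suc (toℕ i ℕ.* 2)) → at2i+1 2m+1≤n i ≡ k
at2i+1-≡ 2m+1≤n i k eq = at-pos (2 ℕ.* pos i ℕ.+ 1) (s≤s z≤n) _ k
  (≡.trans (cong suc (≡.trans eq (2*suc (toℕ i)))) (ℕ.+-comm 1 (2 ℕ.* pos i)))

-- Block decomposition

module WeightedPermanent {ℓ₁ ℓ₂} (R : CommutativeRing ℓ₁ ℓ₂)
  (x : CommutativeRing.Carrier R)
  (x*x≈1 : CommutativeRing._≈_ R (CommutativeRing._*_ R x x) (CommutativeRing.1# R)) where

  open CommutativeRing R hiding (zero) renaming (refl to ≈-refl; sym to ≈-sym; trans to ≈-trans)
  open Matrices R
  open SemiringSum semiring
  open SemiringExp semiring using (^-homo-*; ^-congʳ)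
  open CommutativeMonoidSum *-commutativeMonoid using () renaming (sum to ∏; sum-cong-≋ to ∏-cong)
  open SetoidReasoning setoid
  private
    module *-Solver = CommutativeMonoidSolver *-commutativeMonoid

  -- Expansion of the weighted permanent along the first row

  ∑ᴸ : ∀ {a} {X : Set a} → (X → Carrier) → List X → Carrier
  ∑ᴸ f xs = foldr _+_ 0# (map f xs)

  ∑ᴸ-cong : ∀ {a} {X : Set a} {f g : X → Carrier} → (∀ y → f y ≈ g y) → ∀ ys → ∑ᴸ f ys ≈ ∑ᴸ g ys
  ∑ᴸ-cong f≈g []       = ≈-refl
  ∑ᴸ-cong f≈g (y ∷ ys) = +-cong (f≈g y) (∑ᴸ-cong f≈g ys)

  *-distribˡ-∑ᴸ : ∀ {a} {X : Set a} z (f : X → Carrier) ys → z * ∑ᴸ f ys ≈ ∑ᴸ (λ y → z * f y) ys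
  *-distribˡ-∑ᴸ z f []       = zeroʳ z
  *-distribˡ-∑ᴸ z f (y ∷ ys) = ≈-trans (distribˡ z (f y) _) (+-congˡ (*-distribˡ-∑ᴸ z f ys))

  ∑ᴸ-++ : ∀ {a} {X : Set a} (f : X → Carrier) ys zs → ∑ᴸ f (ys ++ zs) ≈ ∑ᴸ f ys + ∑ᴸ f zs
  ∑ᴸ-++ f []       zs = ≈-sym (+-identityˡ _)
  ∑ᴸ-++ f (y ∷ ys) zs = ≈-trans (+-congˡ (∑ᴸ-++ f ys zs)) (≈-sym (+-assoc _ _ _))

  ∑ᴸ-concatMap-tabulate : ∀ {a b} {X : Set a} {Y : Set b} (f : Y → Carrier) (g : X → List Y) {n} (h : Fin n → X) →
    ∑ᴸ f (concatMap g (tabulate h)) ≈ sum (λ i → ∑ᴸ f (g (h i)))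
  ∑ᴸ-concatMap-tabulate f g {zero}  h = ≈-refl
  ∑ᴸ-concatMap-tabulate f g {suc n} h = ≈-trans (∑ᴸ-++ f (g (h zero)) _)
    (+-congˡ (∑ᴸ-concatMap-tabulate f g (h ∘ suc)))

  -- The list `perms` is assembled in blocks according to the image of the first point.
  ∑ₛ-insert : ∀ n (f : Permutation′ (suc n) → Carrier) →
    ∑ₛ (suc n) f ≈ sum (λ j → ∑ₛ n (f ∘ insert zero j))
  ∑ₛ-insert n f = ≈-trans
    (∑ᴸ-concatMap-tabulate f (λ j → map (insert zero j) (perms n)) id)
    (sum-cong-≋ λ j → reflexive (cong (foldr _+_ 0#) (≡.sym (map-∘ {g = f} {f = insert zero j} (perms n)))))

  sum-zero : ∀ {n} {f : Fin n → Carrier} → (∀ i → f i ≈ 0#) → sum f ≈ 0#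
  sum-zero {n} f≈0 = ≈-trans (sum-cong-≋ f≈0) (sum-replicate-zero n)

  sum-shuffle : ∀ {p q n} (s : Shuffle p q n) (f : Fin n → Carrier) →
    sum f ≈ sum (f ∘ injˡ s) + sum (f ∘ injʳ s)
  sum-shuffle []     f = ≈-sym (+-identityˡ 0#)
  sum-shuffle (ˡ∷ s) f = ≈-trans (+-congˡ (sum-shuffle s (f ∘ suc))) (≈-sym (+-assoc _ _ _))
  sum-shuffle (ʳ∷ s) f = begin
    f zero + sum (f ∘ suc)  ≈⟨ +-congˡ (sum-shuffle s (f ∘ suc)) ⟩
    f zero + (l + r)        ≈⟨ +-assoc _ _ _ ⟨
    (f zero + l) + r        ≈⟨ +-congʳ (+-comm _ _) ⟩
    (l + f zero) + r        ≈⟨ +-assoc _ _ _ ⟩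
    l + (f zero + r)        ∎
    where
    l = sum (f ∘ suc ∘ injˡ s)
    r = sum (f ∘ suc ∘ injʳ s)

  wper : ∀ {n} → Matrix n → Carrier
  wper {n} A = ∑ₛ n λ σ → x ^ inversions σ * ∏ λ i → A i (σ ⟨$⟩ʳ i)

  minor : ∀ {n} → Fin (suc n) → Matrix (suc n) → Matrix n
  minor j A i k = A (suc i) (punchIn j k)

  -- For x = -1 this is a term of the Laplace expansion; the power of x is the cofactor sign.
  expansionTerm : ∀ {n} → Matrix (suc n) → Fin (suc n) → Carrier
  expansionTerm A j = (x ^ toℕ j * A zero j) * wper (minor j A)

  wper-cong : ∀ {n} {A B : Matrix n} → (∀ i j → A i j ≈ B i j) → wper A ≈ wper B
  wper-cong {n} A≈B = ∑ᴸ-cong (λ σ → *-congˡ (∏-cong λ i → A≈B i (σ ⟨$⟩ʳ i))) (perms n)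

  wper-empty : (A : Matrix 0) → wper A ≈ 1#
  wper-empty A = ≈-trans (+-identityʳ _) (*-identityˡ 1#)

  -- Sending the first point to j adds j inversions by `inversions-insert`, and `insert` acts on the
  -- later points through `punchIn j`, so the rest of the product belongs to the minor.
  wper-expansion : ∀ {n} (A : Matrix (suc n)) → wper A ≈ sum (expansionTerm A)
  wper-expansion {n} A = ≈-trans (∑ₛ-insert n _) (sum-cong-≋ λ j →
    ≈-trans (∑ᴸ-cong (summand j) (perms n)) (≈-sym (*-distribˡ-∑ᴸ _ _ (perms n))))
    where
    summand : ∀ j π →
      x ^ inversions (insert zero j π) * (A zero j * ∏ λ i → A (suc i) (insert zero j π ⟨$⟩ʳ suc i)) ≈
      (x ^ toℕ j * A zero j) * (x ^ inversions π * ∏ λ i → minor j A i (π ⟨$⟩ʳ i))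
    summand j π = begin
      x ^ inversions (insert zero j π) * (A zero j * ∏ λ i → A (suc i) (insert zero j π ⟨$⟩ʳ suc i))
        ≈⟨ *-cong
             (≈-trans (^-congʳ x (inversions-insert j π)) (^-homo-* x (toℕ j) (inversions π)))
             (*-congˡ (∏-cong λ i → reflexive (cong (A (suc i)) (insert-punchIn zero j π i)))) ⟩
      (x ^ toℕ j * x ^ inversions π) * (A zero j * ∏ λ i → minor j A i (π ⟨$⟩ʳ i))
        ≈⟨ solve 4 (λ a b c d → (a ⊕ b) ⊕ (c ⊕ d) ⊜ (a ⊕ c) ⊕ (b ⊕ d)) ≈-refl _ _ _ _ ⟩
      (x ^ toℕ j * A zero j) * (x ^ inversions π * ∏ λ i → minor j A i (π ⟨$⟩ʳ i)) ∎
      where open *-Solver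

  x^2d≈1 : ∀ d → x ^ (d ℕ.+ d) ≈ 1#
  x^2d≈1 zero    = ≈-refl
  x^2d≈1 (suc d) = begin
    x * x ^ (d ℕ.+ suc d)    ≈⟨ *-congˡ (^-congʳ x (ℕ.+-suc d d)) ⟩
    x * (x * x ^ (d ℕ.+ d))  ≈⟨ *-assoc x x _ ⟨
    (x * x) * x ^ (d ℕ.+ d)  ≈⟨ *-cong x*x≈1 (x^2d≈1 d) ⟩
    1# * 1#                  ≈⟨ *-identityˡ 1# ⟩
    1#                       ∎

  x^+2d : ∀ k d → x ^ (k ℕ.+ (d ℕ.+ d)) ≈ x ^ k
  x^+2d k d = ≈-trans (^-homo-* x k (d ℕ.+ d)) (≈-trans (*-congˡ (x^2d≈1 d)) (*-identityʳ _))

  expansionTerm-entry-zero : ∀ {n} (A : Matrix (suc n)) j → A zero j ≈ 0# → expansionTerm A j ≈ 0#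
  expansionTerm-entry-zero A j A0j≈0 =
    ≈-trans (*-congʳ (≈-trans (*-congˡ A0j≈0) (zeroʳ _))) (zeroˡ _)

  -- Serves where the entry itself may be nonzero, as for a_{1,1} when n is even.
  expansionTerm-minor-zero : ∀ {n} (A : Matrix (suc n)) j → wper (minor j A) ≈ 0# → expansionTerm A j ≈ 0#
  expansionTerm-minor-zero A j minor≈0 = ≈-trans (*-congˡ minor≈0) (zeroʳ _)

  -- Vanishing and factorization for split matrices

  Split : ∀ {m n p q p′ q′} → (Fin m → Fin n → Carrier) → Shuffle p q m → Shuffle p′ q′ n → Set ℓ₂
  Split A r c = (∀ i j → A (injˡ r i) (injʳ c j) ≈ 0#) × (∀ i j → A (injʳ r i) (injˡ c j) ≈ 0#)

  blockˡ : ∀ {p q p′ n} → Matrix n → Shuffle p q n → Shuffle p p′ n → Matrix p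
  blockˡ A r c i j = A (injˡ r i) (injˡ c j)

  blockʳ : ∀ {p q p′ n} → Matrix n → Shuffle p q n → Shuffle p′ q n → Matrix q
  blockʳ A r c i j = A (injʳ r i) (injʳ c j)

  -- The minor omits the first row, so the condition is imposed only on the rectangular matrix
  -- `A ∘ suc`. This leaves room for an exceptional entry in the first row.
  Split-minorˡ : ∀ {n p q p′ q′} (A : Matrix (suc n)) (r : Shuffle p q n) (c : Shuffle (suc p′) q′ (suc n)) →
    Split (A ∘ suc) r c → ∀ k → Split (minor (injˡ c k) A) r (removeˡ c k)
  Split-minorˡ A r c (lr , rl) k =
    (λ i j → ≈-trans (reflexive (cong (A _) (punchIn-injʳ-removeˡ c k j))) (lr i j)) ,
    (λ i j → ≈-trans (reflexive (cong (A _) (punchIn-injˡ-removeˡ c k j))) (rl i _))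

  Split-minorʳ : ∀ {n p q p′ q′} (A : Matrix (suc n)) (r : Shuffle p q n) (c : Shuffle p′ (suc q′) (suc n)) →
    Split (A ∘ suc) r c → ∀ k → Split (minor (injʳ c k) A) r (removeʳ c k)
  Split-minorʳ A r c (lr , rl) k =
    (λ i j → ≈-trans (reflexive (cong (A _) (punchIn-injʳ-removeʳ c k j))) (lr i _)) ,
    (λ i j → ≈-trans (reflexive (cong (A _) (punchIn-injˡ-removeʳ c k j))) (rl i j))

  Split-tailˡ : ∀ {n p q p′ q′} {A : Matrix (suc n)} {r : Shuffle p q n} {c : Shuffle p′ q′ (suc n)} →
    Split A (ˡ∷ r) c → Split (A ∘ suc) r c
  Split-tailˡ (lr , rl) = (λ i → lr (suc i)) , rl

  Split-tailʳ : ∀ {n p q p′ q′} {A : Matrix (suc n)} {r : Shuffle p q n} {c : Shuffle p′ q′ (suc n)} →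
    Split A (ʳ∷ r) c → Split (A ∘ suc) r c
  Split-tailʳ (lr , rl) = lr , (λ i → rl (suc i))

  -- A permutation with nonzero product would have to match the p left rows with the p′ left
  -- columns. In the induction, the first row keeps only entries of its own class, and deleting one
  -- takes a row and a column from that class, so the sizes still differ.
  wper-nonsquare-blocks : ∀ {n p q p′ q′} (A : Matrix n) (r : Shuffle p q n) (c : Shuffle p′ q′ n) →
    p ≢ p′ → Split A r c → wper A ≈ 0#
  wper-nonsquare-blocks A []     []  p≢p′ split = ⊥-elim (p≢p′ refl)
  wper-nonsquare-blocks A (ˡ∷ r) c p≢p′ split = begin
    wper A                                                              ≈⟨ wper-expansion A ⟩
    sum (expansionTerm A)                                               ≈⟨ sum-shuffle c (expansionTerm A) ⟩
    sum (expansionTerm A ∘ injˡ c) + sum (expansionTerm A ∘ injʳ c)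
      ≈⟨ +-cong (sum-zero (matched c p≢p′ split))
                (sum-zero λ k → expansionTerm-entry-zero A _ (proj₁ split zero k)) ⟩
    0# + 0#                                                             ≈⟨ +-identityˡ 0# ⟩
    0#                                                                  ∎
    where
    -- Quantifying over `c` anew allows matching on its number of letters ˡ, which is a successor
    -- because `k` exists.
    matched : ∀ {p′ q′} (c : Shuffle p′ q′ _) → _ ≢ p′ → Split A (ˡ∷ r) c → ∀ k → expansionTerm A (injˡ c k) ≈ 0#
    matched {suc p′} c p≢p′ split k = expansionTerm-minor-zero A (injˡ c k)
      (wper-nonsquare-blocks (minor (injˡ c k) A) r (removeˡ c k) (p≢p′ ∘ cong suc)
        (Split-minorˡ A r c (Split-tailˡ {A = A} {r} {c} split) k))
  wper-nonsquare-blocks A (ʳ∷ r) c p≢p′ split = begin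
    wper A                                                              ≈⟨ wper-expansion A ⟩
    sum (expansionTerm A)                                               ≈⟨ sum-shuffle c (expansionTerm A) ⟩
    sum (expansionTerm A ∘ injˡ c) + sum (expansionTerm A ∘ injʳ c)
      ≈⟨ +-cong (sum-zero λ k → expansionTerm-entry-zero A _ (proj₂ split zero k))
                (sum-zero (matched c p≢p′ split)) ⟩
    0# + 0#                                                             ≈⟨ +-identityˡ 0# ⟩
    0#                                                                  ∎
    where
    matched : ∀ {p′ q′} (c : Shuffle p′ q′ _) → _ ≢ p′ → Split A (ʳ∷ r) c → ∀ k → expansionTerm A (injʳ c k) ≈ 0#
    matched {q′ = suc q′} c p≢p′ split k = expansionTerm-minor-zero A (injʳ c k)
      (wper-nonsquare-blocks (minor (injʳ c k) A) r (removeʳ c k) p≢p′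
        (Split-minorʳ A r c (Split-tailʳ {A = A} {r} {c} split) k))

  mutual
    -- An entry of the first row outside the block may be nonzero if its minor
    -- vanishes; this accommodates a_{1,1}.
    wper-blocks-firstRowˡ : ∀ {p q n} (A : Matrix (suc n)) (r : Shuffle p q n) (c : Shuffle (suc p) q (suc n)) →
      (∀ k → expansionTerm A (injʳ c k) ≈ 0#) → Split (A ∘ suc) r c →
      wper A ≈ x ^ (shuffleInversions r ℕ.+ shuffleInversions c) *
               (wper (blockˡ A (ˡ∷ r) c) * wper (blockʳ A (ˡ∷ r) c))
    wper-blocks-firstRowˡ A r c unmatched split = begin
      wper A
        ≈⟨ wper-expansion A ⟩
      sum (expansionTerm A)
        ≈⟨ sum-shuffle c (expansionTerm A) ⟩
      sum (expansionTerm A ∘ injˡ c) + sum (expansionTerm A ∘ injʳ c)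
        ≈⟨ +-cong (sum-cong-≋ matched) (sum-zero unmatched) ⟩
      sum (λ k → x ^ w * (expansionTerm B k * wper C)) + 0#
        ≈⟨ +-identityʳ _ ⟩
      sum (λ k → x ^ w * (expansionTerm B k * wper C))
        ≈⟨ *-distribˡ-sum (x ^ w) (λ k → expansionTerm B k * wper C) ⟨
      x ^ w * sum (λ k → expansionTerm B k * wper C)
        ≈⟨ *-congˡ (*-distribʳ-sum (wper C) (expansionTerm B)) ⟨
      x ^ w * (sum (expansionTerm B) * wper C)
        ≈⟨ *-congˡ (*-congʳ (wper-expansion B)) ⟨
      x ^ w * (wper B * wper C) ∎
      where
      w = shuffleInversions r ℕ.+ shuffleInversions c
      B = blockˡ A (ˡ∷ r) c
      C = blockʳ A (ˡ∷ r) c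
      exponent : ∀ k → toℕ (injˡ c k) ℕ.+ (shuffleInversions r ℕ.+ shuffleInversions (removeˡ c k)) ≡ toℕ k ℕ.+ w
      exponent k = ≡.trans (+-swap (toℕ (injˡ c k)) (shuffleInversions r) _)
        (≡.trans (cong (shuffleInversions r ℕ.+_) (shuffleInversions-removeˡ c k))
                 (+-swap (shuffleInversions r) (toℕ k) _))
        where
        +-swap : ∀ a b d → a ℕ.+ (b ℕ.+ d) ≡ b ℕ.+ (a ℕ.+ d)
        +-swap = solve 3 (λ a b d → a :+ (b :+ d) := b :+ (a :+ d)) refl
          where open +-*-Solver
      -- By induction the minor yields a minor of `B` and all of `C`; the factor `wper C` is common
      -- to all k, and what remains is the expansion of `B`.
      matched : ∀ k → expansionTerm A (injˡ c k) ≈ x ^ w * (expansionTerm B k * wper C)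
      matched k = begin
        (x ^ j * a) * wper (minor (injˡ c k) A)
          ≈⟨ *-congˡ (≈-trans (wper-blocks (minor (injˡ c k) A) r (removeˡ c k) (Split-minorˡ A r c split k))
               (*-congˡ (*-cong
                 (wper-cong λ i l → reflexive (cong (A _) (punchIn-injˡ-removeˡ c k l)))
                 (wper-cong λ i l → reflexive (cong (A _) (punchIn-injʳ-removeˡ c k l)))))) ⟩
        (x ^ j * a) * (x ^ w′ * (wper (minor k B) * wper C))
          ≈⟨ solve 5 (λ a b d e f → (a ⊕ b) ⊕ (d ⊕ (e ⊕ f)) ⊜ (a ⊕ d) ⊕ (b ⊕ (e ⊕ f))) ≈-refl _ _ _ _ _ ⟩
        (x ^ j * x ^ w′) * (a * (wper (minor k B) * wper C))
          ≈⟨ *-congʳ (≈-trans (≈-sym (^-homo-* x j w′))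
               (≈-trans (^-congʳ x (exponent k)) (^-homo-* x (toℕ k) w))) ⟩
        (x ^ toℕ k * x ^ w) * (a * (wper (minor k B) * wper C))
          ≈⟨ solve 5 (λ a b d e f → (a ⊕ b) ⊕ (d ⊕ (e ⊕ f)) ⊜ b ⊕ (((a ⊕ d) ⊕ e) ⊕ f)) ≈-refl _ _ _ _ _ ⟩
        x ^ w * (((x ^ toℕ k * a) * wper (minor k B)) * wper C) ∎
        where
        open *-Solver
        j  = toℕ (injˡ c k)
        a  = A zero (injˡ c k)
        w′ = shuffleInversions r ℕ.+ shuffleInversions (removeˡ c k)

    -- Now the right block is expanded and the left block is the common factor. The first row stands
    -- before all p left rows, which puts p more inversions into the exponent.
    wper-blocks-firstRowʳ : ∀ {p q n} (A : Matrix (suc n)) (r : Shuffle p q n) (c : Shuffle p (suc q) (suc n)) →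
      (∀ k → expansionTerm A (injˡ c k) ≈ 0#) → Split (A ∘ suc) r c →
      wper A ≈ x ^ (shuffleInversions (ʳ∷ r) ℕ.+ shuffleInversions c) *
               (wper (blockˡ A (ʳ∷ r) c) * wper (blockʳ A (ʳ∷ r) c))
    wper-blocks-firstRowʳ {p} A r c unmatched split = begin
      wper A
        ≈⟨ wper-expansion A ⟩
      sum (expansionTerm A)
        ≈⟨ sum-shuffle c (expansionTerm A) ⟩
      sum (expansionTerm A ∘ injˡ c) + sum (expansionTerm A ∘ injʳ c)
        ≈⟨ +-cong (sum-zero unmatched) (sum-cong-≋ matched) ⟩
      0# + sum (λ k → (x ^ w * wper B) * expansionTerm C k)
        ≈⟨ +-identityˡ _ ⟩
      sum (λ k → (x ^ w * wper B) * expansionTerm C k)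
        ≈⟨ *-distribˡ-sum (x ^ w * wper B) (expansionTerm C) ⟨
      (x ^ w * wper B) * sum (expansionTerm C)
        ≈⟨ *-congˡ (wper-expansion C) ⟨
      (x ^ w * wper B) * wper C
        ≈⟨ *-assoc _ _ _ ⟩
      x ^ w * (wper B * wper C) ∎
      where
      w = shuffleInversions (ʳ∷ r) ℕ.+ shuffleInversions c
      B = blockˡ A (ʳ∷ r) c
      C = blockʳ A (ʳ∷ r) c
      exponent : ∀ k → x ^ (toℕ (injʳ c k) ℕ.+ (shuffleInversions r ℕ.+ shuffleInversions (removeʳ c k))) ≈
                       x ^ (toℕ k ℕ.+ w)
      exponent k with shuffleInversions-removeʳ c k
      -- The two exponents differ by 2d, which x² = 1 absorbs.
      ... | d , eq = ≈-trans (≈-sym (x^+2d (toℕ (injʳ c k) ℕ.+ (u ℕ.+ shuffleInversions (removeʳ c k))) d)) (^-congʳ x (≡.trans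
        (solve 4 (λ j u v d → j :+ (u :+ v) :+ (d :+ d) := u :+ (j :+ (v :+ (d :+ d)))) refl
          (toℕ (injʳ c k)) u (shuffleInversions (removeʳ c k)) d)
        (≡.trans (cong (u ℕ.+_) eq)
          (solve 4 (λ u k p v → u :+ (k :+ (p :+ v)) := k :+ (p :+ u :+ v)) refl
            u (toℕ k) p (shuffleInversions c)))))
        where
        open +-*-Solver
        u = shuffleInversions r
      matched : ∀ k → expansionTerm A (injʳ c k) ≈ (x ^ w * wper B) * expansionTerm C k
      matched k = begin
        (x ^ j * a) * wper (minor (injʳ c k) A)
          ≈⟨ *-congˡ (≈-trans (wper-blocks (minor (injʳ c k) A) r (removeʳ c k) (Split-minorʳ A r c split k))
               (*-congˡ (*-cong
                 (wper-cong λ i l → reflexive (cong (A _) (punchIn-injˡ-removeʳ c k l)))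
                 (wper-cong λ i l → reflexive (cong (A _) (punchIn-injʳ-removeʳ c k l)))))) ⟩
        (x ^ j * a) * (x ^ w′ * (wper B * wper (minor k C)))
          ≈⟨ solve 5 (λ a b d e f → (a ⊕ b) ⊕ (d ⊕ (e ⊕ f)) ⊜ (a ⊕ d) ⊕ (b ⊕ (e ⊕ f))) ≈-refl _ _ _ _ _ ⟩
        (x ^ j * x ^ w′) * (a * (wper B * wper (minor k C)))
          ≈⟨ *-congʳ (≈-trans (≈-sym (^-homo-* x j w′))
               (≈-trans (exponent k) (^-homo-* x (toℕ k) w))) ⟩
        (x ^ toℕ k * x ^ w) * (a * (wper B * wper (minor k C)))
          ≈⟨ solve 5 (λ a b d e f → (a ⊕ b) ⊕ (d ⊕ (e ⊕ f)) ⊜ (b ⊕ e) ⊕ ((a ⊕ d) ⊕ f)) ≈-refl _ _ _ _ _ ⟩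
        (x ^ w * wper B) * ((x ^ toℕ k * a) * wper (minor k C)) ∎
        where
        open *-Solver
        j  = toℕ (injʳ c k)
        a  = A zero (injʳ c k)
        w′ = shuffleInversions r ℕ.+ shuffleInversions (removeʳ c k)

    -- The class of the first row selects the lemma, and the split makes every unmatched entry of
    -- that row 0. For x = -1 the power of x is the sign of moving the left rows and the left
    -- columns to the front.
    wper-blocks : ∀ {p q n} (A : Matrix n) (r c : Shuffle p q n) → Split A r c →
      wper A ≈ x ^ (shuffleInversions r ℕ.+ shuffleInversions c) * (wper (blockˡ A r c) * wper (blockʳ A r c))
    wper-blocks A [] [] split = begin
      wper A                                  ≈⟨ wper-empty A ⟩
      1#                                      ≈⟨ wper-empty (blockʳ A [] []) ⟨
      wper (blockʳ A [] [])                   ≈⟨ *-identityˡ _ ⟨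
      1# * wper (blockʳ A [] [])              ≈⟨ *-congʳ (wper-empty (blockˡ A [] [])) ⟨
      wper (blockˡ A [] []) * wper (blockʳ A [] []) ≈⟨ *-identityˡ _ ⟨
      1# * (wper (blockˡ A [] []) * wper (blockʳ A [] [])) ∎
    wper-blocks A (ˡ∷ r) c split = wper-blocks-firstRowˡ A r c
      (λ k → expansionTerm-entry-zero A (injʳ c k) (proj₁ split zero k)) (Split-tailˡ {A = A} {r} {c} split)
    wper-blocks A (ʳ∷ r) c split = wper-blocks-firstRowʳ A r c
      (λ k → expansionTerm-entry-zero A (injˡ c k) (proj₂ split zero k)) (Split-tailʳ {A = A} {r} {c} split)

  -- Checkerboard matrices of even and odd size

  Checkerboard : ∀ {n} → Matrix n → Set ℓ₂
  Checkerboard A = ∀ i j → 2 ∣ (pos i ℕ.+ pos j) → 2 < pos i ℕ.+ pos j → A i j ≈ 0#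

  -- Counted from 0, the index sum is smaller by 2, so "even and greater than two" becomes "even and
  -- positive"; `suc k` encodes positivity.
  Checkerboard-zero : ∀ {n} {A : Matrix n} → Checkerboard A → ∀ i j k →
    toℕ i ℕ.+ toℕ j ≡ suc k ℕ.* 2 → A i j ≈ 0#
  Checkerboard-zero zeros i j k eq = zeros i j (divides (2 ℕ.+ k) sum≡)
    (≡.subst (2 <_) (≡.sym sum≡) (s≤s (s≤s (s≤s z≤n))))
    where
    sum≡ : pos i ℕ.+ pos j ≡ (2 ℕ.+ k) ℕ.* 2
    sum≡ = cong suc (≡.trans (ℕ.+-suc (toℕ i) (toℕ j)) (cong suc eq))

  -- The counts are m(m-1)/2 and m(m+1)/2. Their sum m² has the parity of m.
  x^shuffleInversions-alternating : ∀ m →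
    x ^ (shuffleInversions (alternatingˡ m) ℕ.+ shuffleInversions (alternatingʳ m)) ≈ x ^ m
  x^shuffleInversions-alternating zero    = ≈-refl
  x^shuffleInversions-alternating (suc m) = begin
    x ^ (m ℕ.+ u ℕ.+ (suc m ℕ.+ v))
      ≈⟨ ^-congʳ x (solve 3 (λ m u v → m :+ u :+ (con 1 :+ m :+ v) := con 1 :+ (u :+ v) :+ (m :+ m)) refl m u v) ⟩
    x ^ (suc (u ℕ.+ v) ℕ.+ (m ℕ.+ m))
      ≈⟨ x^+2d (suc (u ℕ.+ v)) m ⟩
    x * x ^ (u ℕ.+ v)
      ≈⟨ *-congˡ (x^shuffleInversions-alternating m) ⟩
    x * x ^ m ∎
    where
    open +-*-Solver
    u = shuffleInversions (alternatingˡ m)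
    v = shuffleInversions (alternatingʳ m)

  -- Left are the odd rows and the even columns, counted from 1. Entries of mixed class have even
  -- index sum, so only a_{1,1} among them may be nonzero; it lies in the first row, where
  -- `wper-blocks-firstRowˡ` tolerates it.
  wper-checkerboard-even : ∀ {n} (A : Matrix n) → Checkerboard A →
    ∀ m .{{_ : NonZero m}} → n ≡ m ℕ.* 2 → .(2m≤n : 2 ℕ.* m ≤ n) →
    wper A ≈ x ^ m * wper (λ (i j : Fin m) → A (at2i 2m≤n i) (at2i-1 2m≤n j))
                   * wper (λ (i j : Fin m) → A (at2i-1 2m≤n i) (at2i 2m≤n j))
  wper-checkerboard-even A zeros (suc m) refl 2m≤n = begin
    wper A
      ≈⟨ wper-blocks-firstRowˡ A (ʳ∷ alternatingˡ m) c unmatched split ⟩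
    x ^ (shuffleInversions r ℕ.+ shuffleInversions c) * (wper (blockˡ A r c) * wper (blockʳ A r c))
      -- The right block, with even rows and odd columns, is the first factor in the claim.
      ≈⟨ *-cong (x^shuffleInversions-alternating (suc m)) (*-comm _ _) ⟩
    x ^ suc m * (wper (blockʳ A r c) * wper (blockˡ A r c))
      ≈⟨ *-assoc _ _ _ ⟨
    x ^ suc m * wper (blockʳ A r c) * wper (blockˡ A r c)
      ≈⟨ *-cong
           (*-congˡ (wper-cong λ i j → reflexive (≡.sym (cong₂ A
             (at2i-≡ 2m≤n i (injʳ r i) (toℕ-injʳ-alternatingˡ (suc m) i))
             (at2i-1-≡ 2m≤n j (injʳ c j) (toℕ-injʳ-alternatingʳ (suc m) j))))))
           (wper-cong λ i j → reflexive (≡.sym (cong₂ A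
             (at2i-1-≡ 2m≤n i (injˡ r i) (toℕ-injˡ-alternatingˡ (suc m) i))
             (at2i-≡ 2m≤n j (injˡ c j) (toℕ-injˡ-alternatingʳ (suc m) j))))) ⟩
    x ^ suc m * wper B * wper C ∎
    where
    B C : Matrix (suc m)
    B i j = A (at2i 2m≤n i) (at2i-1 2m≤n j)
    C i j = A (at2i-1 2m≤n i) (at2i 2m≤n j)
    r = alternatingˡ (suc m)
    c = alternatingʳ (suc m)
    split : Split (A ∘ suc) (ʳ∷ alternatingˡ m) c
    split =
      (λ i j → Checkerboard-zero zeros (injˡ r (suc i)) (injʳ c j) (toℕ i ℕ.+ toℕ j)
        (≡.trans (cong₂ ℕ._+_ (toℕ-injˡ-alternatingˡ (suc m) (suc i)) (toℕ-injʳ-alternatingʳ (suc m) j))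
                 (≡.sym (ℕ.*-distribʳ-+ 2 (suc (toℕ i)) (toℕ j))))) ,
      (λ i j → Checkerboard-zero zeros (injʳ r i) (injˡ c j) (toℕ i ℕ.+ toℕ j)
        (≡.trans (cong₂ ℕ._+_ (toℕ-injʳ-alternatingˡ (suc m) i) (toℕ-injˡ-alternatingʳ (suc m) j))
                 (solve 2 (λ i j → con 1 :+ i :* con 2 :+ (con 1 :+ j :* con 2) := (con 1 :+ (i :+ j)) :* con 2)
                    refl (toℕ i) (toℕ j))))
      where open +-*-Solver
    unmatched : ∀ k → expansionTerm A (injʳ c k) ≈ 0#
    -- Without the first row and column there remain m odd rows but m + 1 even columns.
    unmatched zero    = expansionTerm-minor-zero A zero
      (wper-nonsquare-blocks (minor zero A) (ʳ∷ alternatingˡ m) (ˡ∷ alternatingʳ m) (λ ())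
        (Split-minorʳ A (ʳ∷ alternatingˡ m) c split zero))
    unmatched (suc k) = expansionTerm-entry-zero A (injʳ c (suc k))
      (Checkerboard-zero zeros zero (injʳ c (suc k)) (toℕ k) (toℕ-injʳ-alternatingʳ (suc m) (suc k)))

  -- Now the left class has the even rows and the odd columns. In the first row, later entries in
  -- odd columns are 0 and those in even columns have minors with nonsquare blocks; only a_{1,1}
  -- survives, and its minor splits into two square blocks.
  wper-checkerboard-odd : ∀ {n} .{{_ : NonZero n}} (A : Matrix n) → Checkerboard A →
    ∀ m .{{_ : NonZero m}} → n ≡ suc (m ℕ.* 2) → .(2m≤n : 2 ℕ.* m ≤ n) .(2m+1≤n : 2 ℕ.* m ℕ.+ 1 ≤ n) →
    wper A ≈ x ^ m * A first first
                   * wper (λ (i j : Fin m) → A (at2i 2m≤n i) (at2i+1 2m+1≤n j))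
                   * wper (λ (i j : Fin m) → A (at2i+1 2m+1≤n i) (at2i 2m≤n j))
  wper-checkerboard-odd A zeros m@(suc m-1) refl 2m≤n 2m+1≤n = begin
    wper A
      ≈⟨ wper-expansion A ⟩
    sum (expansionTerm A)
      ≈⟨ sum-shuffle c (expansionTerm A) ⟩
    expansionTerm A zero + sum (λ k → expansionTerm A (injˡ c (suc k))) + sum (expansionTerm A ∘ injʳ c)
      ≈⟨ +-cong (+-congˡ (sum-zero laterˡ)) (sum-zero laterʳ) ⟩
    expansionTerm A zero + 0# + 0#
      ≈⟨ ≈-trans (+-identityʳ _) (+-identityʳ _) ⟩
    (1# * A zero zero) * wper (minor zero A)
      ≈⟨ *-cong (*-identityˡ _)
           (≈-trans (wper-blocks (minor zero A) r c′ (Split-minorˡ A r c split zero))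
             (*-cong (x^shuffleInversions-alternating m) (*-cong
               (wper-cong λ i j → reflexive (≡.sym (cong₂ A
                 (at2i-≡ 2m≤n i (suc (injˡ r i)) (cong suc (toℕ-injˡ-alternatingˡ m i)))
                 (at2i+1-≡ 2m+1≤n j (suc (injˡ c′ j)) (cong suc (toℕ-injˡ-alternatingʳ m j))))))
               (wper-cong λ i j → reflexive (≡.sym (cong₂ A
                 (at2i+1-≡ 2m+1≤n i (suc (injʳ r i)) (cong suc (toℕ-injʳ-alternatingˡ m i)))
                 (at2i-≡ 2m≤n j (suc (injʳ c′ j)) (cong suc (toℕ-injʳ-alternatingʳ m j))))))))) ⟩
    A zero zero * (x ^ m * (wper B * wper C))
      ≈⟨ solve 4 (λ a b d e → a ⊕ (b ⊕ (d ⊕ e)) ⊜ ((b ⊕ a) ⊕ d) ⊕ e) ≈-refl _ _ _ _ ⟩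
    -- `first` reduces to `zero`, so this is the claimed product.
    x ^ m * A zero zero * wper B * wper C ∎
    where
    open *-Solver
    r  = alternatingˡ m
    c′ = alternatingʳ m
    c  = ˡ∷ c′
    B C : Matrix m
    B i j = A (at2i 2m≤n i) (at2i+1 2m+1≤n j)
    C i j = A (at2i+1 2m+1≤n i) (at2i 2m≤n j)
    split : Split (A ∘ suc) r c
    split =
      (λ i j → Checkerboard-zero zeros (suc (injˡ r i)) (injʳ c j) (toℕ i ℕ.+ toℕ j)
        (≡.trans (cong₂ (λ s t → suc s ℕ.+ suc t) (toℕ-injˡ-alternatingˡ m i) (toℕ-injʳ-alternatingʳ m j))
                 (N.solve 2 (λ i j → N.con 1 N.:+ i N.:* N.con 2 N.:+ (N.con 1 N.:+ j N.:* N.con 2)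
                                     N.:= (N.con 1 N.:+ (i N.:+ j)) N.:* N.con 2)
                    refl (toℕ i) (toℕ j)))) ,
      (λ i j → Checkerboard-zero zeros (suc (injʳ r i)) (injˡ c j) (toℕ i ℕ.+ toℕ j)
        (≡.trans (cong₂ (λ s t → suc s ℕ.+ t) (toℕ-injʳ-alternatingˡ m i) (toℕ-injˡ-c j))
                 (≡.sym (ℕ.*-distribʳ-+ 2 (suc (toℕ i)) (toℕ j)))))
      where
      module N = +-*-Solver
      toℕ-injˡ-c : ∀ j → toℕ (injˡ c j) ≡ toℕ j ℕ.* 2
      toℕ-injˡ-c zero    = refl
      toℕ-injˡ-c (suc j) = cong suc (toℕ-injˡ-alternatingʳ m j)
    laterˡ : ∀ k → expansionTerm A (injˡ c (suc k)) ≈ 0#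
    laterˡ k = expansionTerm-entry-zero A (injˡ c (suc k))
      (Checkerboard-zero zeros zero (injˡ c (suc k)) (toℕ k) (cong suc (toℕ-injˡ-alternatingʳ m k)))
    laterʳ : ∀ k → expansionTerm A (injʳ c k) ≈ 0#
    laterʳ k = expansionTerm-minor-zero A (injʳ c k)
      -- Deleting an even column leaves m even rows against all m + 1 odd columns.
      (wper-nonsquare-blocks (minor (injʳ c k) A) r (removeʳ c k) (λ ()) (Split-minorʳ A r c split k))

-- The weights 1 and -1

module PerDet {ℓ₁ ℓ₂} (R : CommutativeRing ℓ₁ ℓ₂) where

  open CommutativeRing R hiding (zero) renaming (refl to ≈-refl; sym to ≈-sym; trans to ≈-trans)
  open Matrices R
  open RingProperties ring using (-1*x≈-x; -‿involutive)

  module Per = WeightedPermanent R 1# (*-identityˡ 1#)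
  module Det = WeightedPermanent R (- 1#) (≈-trans (-1*x≈-x (- 1#)) (-‿involutive 1#))

  1^n*x≈x : ∀ n x → 1# ^ n * x ≈ x
  1^n*x≈x zero    x = *-identityˡ x
  1^n*x≈x (suc n) x = ≈-trans (*-congʳ (*-identityˡ _)) (1^n*x≈x n x)

  wper≈per : ∀ {n} (A : Matrix n) → Per.wper A ≈ per A
  wper≈per {n} A = Per.∑ᴸ-cong (λ σ → 1^n*x≈x (inversions σ) _) (perms n)

theorem1p1 : ∀ {c ℓ} (R : CommutativeRing c ℓ) →
  let open CommutativeRing R
      open Matrices R
  in
  (n : ℕ) .{{_ : NonZero n}} (A : Matrix n) →
  (∀ i j → 2 ∣ (pos i ℕ.+ pos j) → 2 < pos i ℕ.+ pos j → A i j ≈ 0#) →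
  ((m : ℕ) .{{_ : NonZero m}} (n≡2m : n ≡ 2 ℕ.* m) →
    let 2m≤n = ≤-reflexive (≡.sym n≡2m) in
    (per A ≈ per (λ (i j : Fin m) → A (at2i 2m≤n i) (at2i-1 2m≤n j))
           * per (λ (i j : Fin m) → A (at2i-1 2m≤n i) (at2i 2m≤n j)))
    ×
    (det A ≈ ((- 1#) ^ m) * det (λ (i j : Fin m) → A (at2i 2m≤n i) (at2i-1 2m≤n j))
           * det (λ (i j : Fin m) → A (at2i-1 2m≤n i) (at2i 2m≤n j))))
  ×
  ((m : ℕ) .{{_ : NonZero m}} (n≡2m+1 : n ≡ 2 ℕ.* m ℕ.+ 1) →
    let 2m+1≤n = ≤-reflexive (≡.sym n≡2m+1)
        2m≤n   = m+n≤o⇒m≤o (2 ℕ.* m) 2m+1≤n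
    in
    (per A ≈ A first first
           * per (λ (i j : Fin m) → A (at2i 2m≤n i) (at2i+1 2m+1≤n j))
           * per (λ (i j : Fin m) → A (at2i+1 2m+1≤n i) (at2i 2m≤n j)))
    ×
    (det A ≈ ((- 1#) ^ m) * A first first
           * det (λ (i j : Fin m) → A (at2i 2m≤n i) (at2i+1 2m+1≤n j))
           * det (λ (i j : Fin m) → A (at2i+1 2m+1≤n i) (at2i 2m≤n j))))
theorem1p1 R n A zeros =
  (λ m n≡2m →
    let n≡m*2 = ≡.trans n≡2m (ℕ.*-comm 2 m)
        2m≤n  = ≤-reflexive (≡.sym n≡2m)
        B     = λ (i j : Fin m) → A (at2i 2m≤n i) (at2i-1 2m≤n j)
        C     = λ (i j : Fin m) → A (at2i-1 2m≤n i) (at2i 2m≤n j)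
    in
    (begin
      per A                         ≈⟨ wper≈per A ⟨
      Per.wper A                    ≈⟨ Per.wper-checkerboard-even A zeros m n≡m*2 2m≤n ⟩
      1# ^ m * Per.wper B * Per.wper C ≈⟨ *-cong (≈-trans (1^n*x≈x m _) (wper≈per B)) (wper≈per C) ⟩
      per B * per C                 ∎) ,
    -- `det` unfolds to `Det.wper`, so only the permanent needs its weights removed.
    Det.wper-checkerboard-even A zeros m n≡m*2 2m≤n) ,
  (λ m n≡2m+1 →
    let n≡1+m*2 = ≡.trans n≡2m+1 (≡.trans (ℕ.+-comm (2 ℕ.* m) 1) (cong suc (ℕ.*-comm 2 m)))
        2m+1≤n  = ≤-reflexive (≡.sym n≡2m+1)
        2m≤n    = m+n≤o⇒m≤o (2 ℕ.* m) 2m+1≤n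
        B       = λ (i j : Fin m) → A (at2i 2m≤n i) (at2i+1 2m+1≤n j)
        C       = λ (i j : Fin m) → A (at2i+1 2m+1≤n i) (at2i 2m≤n j)
    in
    (begin
      per A                         ≈⟨ wper≈per A ⟨
      Per.wper A                    ≈⟨ Per.wper-checkerboard-odd A zeros m n≡1+m*2 2m≤n 2m+1≤n ⟩
      1# ^ m * A first first * Per.wper B * Per.wper C
        ≈⟨ *-cong (*-cong (1^n*x≈x m _) (wper≈per B)) (wper≈per C) ⟩
      A first first * per B * per C ∎) ,
    Det.wper-checkerboard-odd A zeros m n≡1+m*2 2m≤n 2m+1≤n)
  where
  open CommutativeRing R hiding (zero) renaming (refl to ≈-refl; sym to ≈-sym; trans to ≈-trans)
  open Matrices R
  open PerDet R
  open SetoidReasoning setoid
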